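{- Let $n\geq 1$ and let $C$ be a CRC in $G_n$ with covering radius $\rho\geq 1$, $a_0=0$ and $a_1=1$. Then $c_1=1$, and there is a CRC $D$ in the ternary Hamming graph $H(n,3)$ with the same parameter matrix such that $C=\{x\in\mathbb{Z}^n: (x_1\bmod 3,\ldots,x_n\bmod 3)\in D\}$.
   Context: $G_n$: vertex set $\mathbb{Z}^n$, $x\sim y$ iff $\sum_i|x_i-y_i|=1$. $H(n,3)$: vertex set $\{0,1,2\}^n$, adjacent iff differing in exactly one coordinate. For a code $C$ in a graph with covering radius $\rho$, $C_i=\{v:d(v,C)=i\}$; $C$ is a CRC if for all $i,j$ every vertex of $C_i$ has the same number $\alpha_{ij}$ of neighbours in $C_j$, with $\alpha_{ij}=0$ for $|i-j|>1$; $a_i=\alpha_{ii}$, $b_i=\alpha_{i,i+1}$, $c_i=\alpha_{i,i-1}$, and the parameter matrix is $(\alpha_{ij})$. -}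

module Defs where

open import Level using (Level; 0ℓ)
open import Data.Nat.Base using (ℕ; zero; suc; _≤_; _<_; s≤s; ∣_-_∣)
open import Data.Fin.Base using (Fin; zero; suc; toℕ; fromℕ<)
open import Data.Integer.Base as ℤ using (ℤ)
open import Data.Integer.DivMod using (n%ℕd<d)
open import Data.Integer.Properties using (∣i-j∣≡∣j-i∣; +-inverseʳ)
open import Data.List.Base using (List; length)
open import Data.List.Membership.Propositional using () renaming (_∈_ to _∈ˡ_)
open import Data.List.Relation.Unary.Unique.Propositional using (Unique)
open import Data.Product using (∃!; ∃-syntax; _×_; _,_)
open import Data.Vec.Base using (Vec; []; _∷_; lookup; sum; zipWith)
open import Data.Vec.Properties using (zipWith-comm)
open import Function.Base using (_∘_)
open import Function.Bundles using (_⇔_)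
open import Relation.Binary.Core using (Rel)
open import Relation.Binary.Definitions using (Symmetric; Irreflexive)
open import Relation.Binary.PropositionalEquality using (_≡_; _≢_; refl; sym; trans; cong)
open import Relation.Unary using (Pred; _∈_)

record Graph : Set₁ where
  field
    Vertex     : Set
    _~_        : Rel Vertex 0ℓ
    ~-sym      : Symmetric _~_
    ~-irrefl   : Irreflexive _≡_ _~_

IsLeast : ∀ {ℓ} → Pred ℕ ℓ → Pred ℕ ℓ
IsLeast P m = P m × (∀ k → P k → m ≤ k)

HasCardinality : ∀ {a ℓ} {A : Set a} → Pred A ℓ → ℕ → Set _
HasCardinality {A = A} P k =
  ∃[ xs ] Unique {A = A} xs × (∀ x → x ∈ˡ xs ⇔ x ∈ P) × length xs ≡ k

Matrix : ℕ → Set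
Matrix m = Fin m → Fin m → ℕ

module _ (G : Graph) where
  open Graph G

  data Walk : Vertex → Vertex → ℕ → Set where
    here : ∀ {u} → Walk u u zero
    step : ∀ {u v w k} → u ~ v → Walk v w k → Walk u w (suc k)

  -- d(u,v) = k
  Distance : Vertex → Vertex → ℕ → Set
  Distance u v = IsLeast (Walk u v)

  module _ {ℓ : Level} (C : Pred Vertex ℓ) where

    -- d(v,C) = k
    DistanceToCode : Vertex → ℕ → Set ℓ
    DistanceToCode v = IsLeast (λ k → ∃[ c ] c ∈ C × Distance v c k)

    -- C_i = { v : d(v,C) = i }
    Layer : ℕ → Pred Vertex ℓ
    Layer i v = DistanceToCode v i

    -- ρ is the maximum of d(v,C) over all vertices v. In particular C is
    -- nonempty, and v ∈ C is decidable because d(v,C) is given for every v.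
    IsCoveringRadius : ℕ → Set ℓ
    IsCoveringRadius ρ =
      (∀ v → ∃[ i ] i ≤ ρ × DistanceToCode v i) × (∃[ v ] DistanceToCode v ρ)

    record IsCRC (ρ : ℕ) (α : Matrix (suc ρ)) : Set ℓ where
      field
        coveringRadius : IsCoveringRadius ρ
        regular        : ∀ i j v → v ∈ Layer (toℕ i) →
                         HasCardinality (λ w → v ~ w × w ∈ Layer (toℕ j)) (α i j)
        tridiagonal    : ∀ i j → 1 < ∣ toℕ i - toℕ j ∣ → α i j ≡ 0

ℓ₁-distance : ∀ {n} → Vec ℤ n → Vec ℤ n → ℕ
ℓ₁-distance x y = sum (zipWith (λ a b → ℤ.∣ a ℤ.- b ∣) x y)

private
  ℓ₁-comm : ∀ {n} (x y : Vec ℤ n) → ℓ₁-distance x y ≡ ℓ₁-distance y x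
  ℓ₁-comm x y = cong sum (zipWith-comm ∣i-j∣≡∣j-i∣ x y)

  ℓ₁-self : ∀ {n} (x : Vec ℤ n) → ℓ₁-distance x x ≡ 0
  ℓ₁-self []      = refl
  ℓ₁-self (a ∷ x) rewrite +-inverseʳ a = ℓ₁-self x

GridGraph : ℕ → Graph
GridGraph n = record
  { Vertex   = Vec ℤ n
  ; _~_      = λ x y → ℓ₁-distance x y ≡ 1
  ; ~-sym    = λ {x} {y} p → trans (ℓ₁-comm y x) p
  ; ~-irrefl = λ { {x} refl p → 0≢1 (trans (sym (ℓ₁-self x)) p) }
  }
  where
  0≢1 : 0 ≢ 1
  0≢1 ()

-- H(n,q) on Vec (Fin q) n
HammingGraph : ℕ → ℕ → Graph
HammingGraph n q = record
  { Vertex   = Vec (Fin q) n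
  ; _~_      = λ x y → ∃! _≡_ (λ i → lookup x i ≢ lookup y i)
  ; ~-sym    = λ (i , xᵢ≢yᵢ , unique) → i , xᵢ≢yᵢ ∘ sym , λ p → unique (p ∘ sym)
  ; ~-irrefl = λ { refl (_ , xᵢ≢xᵢ , _) → xᵢ≢xᵢ refl }
  }

-- _%ℕ_ is the nonnegative remainder, also for negative integers.
mod3 : ℤ → Fin 3
mod3 a = fromℕ< (n%ℕd<d a 3)

-- The indices 0 and 1 of rows and columns of a parameter matrix.
index₀ : ∀ {ρ} → Fin (suc ρ)
index₀ = zero

index₁ : ∀ {ρ} → 1 ≤ ρ → Fin (suc ρ)
index₁ 1≤ρ = fromℕ< (s≤s 1≤ρ)

{-# OPTIONS --safe #-}

-- Let v ∈ C. All neighbours of v lie in C₁ since a₀ = 0. A diagonal vertex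
-- v ± eᵢ ± eⱼ with i ≠ j has two neighbours in C₁, so it is not in C₁ because
-- a₁ = 1. Hence the only neighbour of v + s eᵢ in C₁ is v + 2s eᵢ. A codeword next
-- to v + 2s eᵢ that is off the line through v in direction i would have v + s eᵢ ∈ C₁
-- as a diagonal vertex, so the only codeword next to v + 2s eᵢ is v + 3s eᵢ. This
-- shows c₁ = 1 and that C is invariant under 3ℤⁿ. Finally ℤⁿ → (ℤ/3)ⁿ is a
-- covering of graphs Gₙ → H(n,3), and coverings preserve layers and parameters.

module Submission where

open import Defs
open import Level using (Level)
open import Data.Nat.Base as ℕ using (ℕ; zero; suc; _≤_; z≤n; s≤s)
open import Data.Nat.Induction using (<-rec)
open import Data.Nat.Properties as ℕ using (_≤?_; ≰⇒>)
open import Data.Integer.Base as ℤ using (ℤ; +_; -[1+_]; 0ℤ; 1ℤ; -1ℤ)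
open import Data.Integer.Properties as ℤ using ()
open import Data.Integer.Tactic.RingSolver using (solve-∀)
open import Data.Fin.Base using (Fin; zero; suc; toℕ)
open import Data.Fin.Properties using (_≟_)
open import Data.List.Base as List using (List; []; _∷_)
open import Data.List.Membership.Propositional using () renaming (_∈_ to _∈ˡ_)
open import Data.List.Membership.Propositional.Properties using (∈-map⁺; ∈-map⁻)
open import Data.List.Properties using (length-map)
open import Data.List.Relation.Unary.All as All using (_∷_)
open import Data.List.Relation.Unary.All.Properties as All using ()
open import Data.List.Relation.Unary.AllPairs using ([]; _∷_)
open import Data.List.Relation.Unary.Any using (here; there)
open import Data.List.Relation.Unary.Unique.Propositional using (Unique)
open import Data.Product using (Σ-syntax; ∃-syntax; ∃₂; _×_; _,_; proj₁; proj₂)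
open import Data.Sign.Base as Sign using (Sign; opposite)
open import Data.Sum.Base using (_⊎_; inj₁; inj₂)
open import Data.Vec.Base using (Vec; []; _∷_; map; lookup; updateAt)
open import Data.Vec.Properties using (lookup-map; lookup∘updateAt; lookup∘updateAt′; tabulate-cong; tabulate∘lookup; updateAt-commutes; updateAt-id-local; updateAt-updateAt-local)
open import Function.Base using (_∘_; case_of_)
open import Function.Bundles using (_⇔_; mk⇔; Equivalence)
open import Function.Properties.Equivalence using () renaming (refl to ⇔-refl; sym to ⇔-sym; trans to ⇔-trans)
open import Relation.Binary.PropositionalEquality using (_≡_; _≢_; refl; sym; trans; cong; subst; module ≡-Reasoning)
open import Relation.Nullary using (yes; no; contradiction)
open import Relation.Nullary.Decidable using (decidable-stable)
open import Relation.Unary using (Pred; _∈_; _∉_; _≐_)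

open Equivalence using (to; from)

private
  variable
    a b p q ℓ : Level
    A : Set a
    B : Set b

-- Cardinalities

cardinality-0⇒∉ : {P : Pred A p} → HasCardinality P 0 → ∀ {x} → x ∉ P
cardinality-0⇒∉ ([] , _ , ∈⇔ , _) x∈P = case from (∈⇔ _) x∈P of λ ()

cardinality-1⇒unique : {P : Pred A p} → HasCardinality P 1 →
                       ∀ {x y} → x ∈ P → y ∈ P → x ≡ y
cardinality-1⇒unique (_ ∷ [] , _ , ∈⇔ , _) x∈P y∈P
  with here refl ← from (∈⇔ _) x∈P | here refl ← from (∈⇔ _) y∈P = refl

cardinality-1⇒nonempty : {P : Pred A p} → HasCardinality P 1 → ∃[ x ] x ∈ P
cardinality-1⇒nonempty (x ∷ [] , _ , ∈⇔ , _) = x , to (∈⇔ x) (here refl)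

singleton⇒cardinality-1 : ∀ {P : Pred A p} {k x} → HasCardinality P k →
                          x ∈ P → (∀ {y} → y ∈ P → y ≡ x) → k ≡ 1
singleton⇒cardinality-1 ([] , _ , ∈⇔ , _) x∈P _ = case from (∈⇔ _) x∈P of λ ()
singleton⇒cardinality-1 (_ ∷ [] , _ , _ , refl) _ _ = refl
singleton⇒cardinality-1 (y ∷ z ∷ _ , (y≢z ∷ _) ∷ _ , ∈⇔ , _) _ ≡x =
  contradiction (trans (≡x (to (∈⇔ y) (here refl))) (sym (≡x (to (∈⇔ z) (there (here refl)))))) y≢z

-- Injectivity is asked only on members of the list, since a covering projection is injective only
-- on the neighbourhood of a vertex.
unique-map : (f : A → B) {xs : List A} →
             (∀ {x y} → x ∈ˡ xs → y ∈ˡ xs → f x ≡ f y → x ≡ y) →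
             Unique xs → Unique (List.map f xs)
unique-map f inj [] = []
unique-map f inj (x∉xs ∷ unique) =
  All.map⁺ (All.tabulate λ y∈xs fx≡fy →
    All.lookup x∉xs y∈xs (inj (here refl) (there y∈xs) fx≡fy)) ∷
  unique-map f (λ x∈ y∈ → inj (there x∈) (there y∈)) unique

cardinality-map : ∀ {P : Pred A p} {Q : Pred B q} {k} (f : A → B) →
                  (∀ {x} → x ∈ P → f x ∈ Q) →
                  (∀ {y} → y ∈ Q → ∃[ x ] x ∈ P × f x ≡ y) →
                  (∀ {x y} → x ∈ P → y ∈ P → f x ≡ f y → x ≡ y) →
                  HasCardinality P k → HasCardinality Q k
cardinality-map {Q = Q} f maps onto inj (xs , unique , ∈⇔ , length≡k) =
  List.map f xs ,
  unique-map f (λ x∈ y∈ → inj (to (∈⇔ _) x∈) (to (∈⇔ _) y∈)) unique ,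
  (λ y → mk⇔
    (λ y∈ → let x , x∈xs , y≡fx = ∈-map⁻ f y∈ in subst Q (sym y≡fx) (maps (to (∈⇔ x) x∈xs)))
    (λ y∈Q → let x , x∈P , fx≡y = onto y∈Q in
      subst (_∈ˡ List.map f xs) fx≡y (∈-map⁺ f (from (∈⇔ x) x∈P)))) ,
  trans (length-map f xs) length≡k

-- Layers

isLeast-cong : ∀ {P : Pred ℕ p} {Q : Pred ℕ q} → (∀ k → P k ⇔ Q k) → ∀ {m} → IsLeast P m → IsLeast Q m
isLeast-cong P⇔Q (Pm , least) = to (P⇔Q _) Pm , λ k Qk → least k (from (P⇔Q k) Qk)

module _ (G : Graph) (C : Pred (Graph.Vertex G) ℓ) where
  open Graph G

  Reaches : Vertex → ℕ → Set ℓ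
  Reaches v k = ∃[ c ] c ∈ C × Walk G v c k

  -- Whether a walk of given length exists is not decidable, so distances to
  -- individual codewords need not exist; the bound i ≤ k is decidable, however.
  layer⇔leastWalk : ∀ {i v} → v ∈ Layer G C i ⇔ IsLeast (Reaches v) i
  layer⇔leastWalk {i} {v} = mk⇔
    (λ { ((c , c∈C , w , _) , least) → (c , c∈C , w) , <-rec (λ k → Reaches v k → i ≤ k) (bound least) })
    (λ { ((c , c∈C , w) , least) →
      (c , c∈C , w , λ k w′ → least k (c , c∈C , w′)) ,
      λ { k (c′ , c′∈C , w′ , _) → least k (c′ , c′∈C , w′) } })
    where
    bound : (∀ k → (∃[ c ] c ∈ C × Distance G v c k) → i ≤ k) →
            ∀ k → (∀ {m} → m ℕ.< k → Reaches v m → i ≤ m) → Reaches v k → i ≤ k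
    bound least k rec (c , c∈C , w) with i ≤? k
    ... | yes i≤k = i≤k
    -- Here `k` is smaller than `i`. A shorter walk to `c` would by induction have length at least
    -- `i`, so this walk realises the distance to `c` and `least` applies.
    ... | no  i≰k = least k (c , c∈C , w , shortest)
      where
      shortest : ∀ m → Walk G v c m → k ≤ m
      shortest m w′ with k ≤? m
      ... | yes k≤m = k≤m
      ... | no  k≰m = contradiction
        (ℕ.≤-trans (rec (≰⇒> k≰m) (c , c∈C , w′)) (ℕ.<⇒≤ (≰⇒> k≰m))) i≰k

  layer-0⇔∈ : ∀ {v} → v ∈ Layer G C 0 ⇔ v ∈ C
  layer-0⇔∈ {v} = mk⇔
    (λ { ((_ , v∈C , here , _) , _) → v∈C })
    (λ v∈C → (v , v∈C , here , λ _ _ → z≤n) , λ _ _ → z≤n)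

  layer-1⇒∉ : ∀ {v} → v ∈ Layer G C 1 → v ∉ C
  layer-1⇒∉ v∈C₁ v∈C = case proj₂ v∈C₁ 0 (proj₁ (from layer-0⇔∈ v∈C)) of λ ()

  layer-1⇒neighbour : ∀ {v} → v ∈ Layer G C 1 → ∃[ c ] v ~ c × c ∈ C
  layer-1⇒neighbour ((c , c∈C , step v~c here , _) , _) = c , v~c , c∈C

  neighbour⇒layer-1 : ∀ {v c} → v ∉ C → v ~ c → c ∈ C → v ∈ Layer G C 1
  neighbour⇒layer-1 {v} {c} v∉C v~c c∈C = from layer⇔leastWalk
    ((c , c∈C , step v~c here) , positive)
    where
    positive : ∀ k → Reaches v k → 1 ≤ k
    positive zero    (_ , v∈C , here) = contradiction v∈C v∉C
    positive (suc _) _                = s≤s z≤n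

-- Graph coverings

-- The last three fields say that `proj` maps the neighbours of `u` bijectively onto those of
-- `proj u`. Surjectivity on vertices is given by a chosen preimage, `section`.
record Covering (G H : Graph) : Set where
  private
    module G = Graph G
    module H = Graph H
  field
    proj         : G.Vertex → H.Vertex
    section      : H.Vertex → G.Vertex
    proj-section : ∀ y → proj (section y) ≡ y
    proj-~       : ∀ {u v} → u G.~ v → proj u H.~ proj v
    lift-~       : ∀ {u y} → proj u H.~ y → ∃[ v ] u G.~ v × proj v ≡ y
    proj-inj     : ∀ {u v w} → u G.~ v → u G.~ w → proj v ≡ proj w → v ≡ w

module _ {G H : Graph} (π : Covering G H) where
  open Covering π
  private
    module G = Graph G
    module H = Graph H

  walk-proj : ∀ {u v k} → Walk G u v k → Walk H (proj u) (proj v) k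
  walk-proj here         = here
  walk-proj (step u~v w) = step (proj-~ u~v) (walk-proj w)

  walk-lift : ∀ {u y k} → Walk H (proj u) y k → ∃[ v ] proj v ≡ y × Walk G u v k
  walk-lift here = _ , refl , here
  walk-lift (step u~y w) with v , u~v , refl ← lift-~ u~y =
    let z , projz≡ , w′ = walk-lift w in z , projz≡ , step u~v w′

  module _ {C : Pred G.Vertex ℓ} {D : Pred H.Vertex ℓ} (C⇔D : ∀ v → v ∈ C ⇔ proj v ∈ D) where

    -- Walks project and lift with their length unchanged. The end of a lifted walk is a codeword
    -- because membership in `C` depends only on the image.
    reaches⇔ : ∀ v k → Reaches G C v k ⇔ Reaches H D (proj v) k
    reaches⇔ v k = mk⇔
      (λ { (c , c∈C , w) → proj c , to (C⇔D c) c∈C , walk-proj w })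
      (λ { (d , d∈D , w) → case walk-lift w of
        λ { (c , refl , w′) → c , from (C⇔D c) d∈D , w′ } })

    layer⇔ : ∀ {i v} → v ∈ Layer G C i ⇔ proj v ∈ Layer H D i
    layer⇔ {i} {v} = ⇔-trans (layer⇔leastWalk G C)
      (⇔-trans (mk⇔ (isLeast-cong (reaches⇔ v)) (isLeast-cong (⇔-sym ∘ reaches⇔ v)))
               (⇔-sym (layer⇔leastWalk H D)))

    isCRC-proj : ∀ {ρ α} → IsCRC G C ρ α → IsCRC H D ρ α
    isCRC-proj crc = record
      { coveringRadius =
          (λ y → let i , i≤ρ , d = proj₁ coveringRadius (section y) in
            i , i≤ρ , subst (_∈ Layer H D i) (proj-section y) (to layer⇔ d)) ,
          (let v , d = proj₂ coveringRadius in proj v , to layer⇔ d)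
      -- The count at `y` is the count at its preimage `section y`: the local bijection on
      -- neighbours preserves layers.
      ; regular = λ i j y y∈Dᵢ →
          subst (λ z → HasCardinality (λ w → z H.~ w × w ∈ Layer H D (toℕ j)) _) (proj-section y)
            (cardinality-map proj
              (λ { (v~w , w∈Cⱼ) → proj-~ v~w , to layer⇔ w∈Cⱼ })
              (λ { (v~w , w∈Dⱼ) → case lift-~ v~w of
                λ { (w , v~w , refl) → w , (v~w , from layer⇔ w∈Dⱼ) , refl } })
              (λ { (v~x , _) (v~y , _) → proj-inj v~x v~y })
              (regular i j (section y)
                (from layer⇔ (subst (_∈ Layer H D (toℕ i)) (sym (proj-section y)) y∈Dᵢ))))
      ; tridiagonal = tridiagonal
      }
      where open IsCRC crc

-- The grid

private
  variable
    n : ℕ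

translate : Fin n → ℤ → Vec ℤ n → Vec ℤ n
translate i k x = updateAt x i (λ a → k ℤ.+ a)

translate-0 : ∀ (i : Fin n) x → translate i 0ℤ x ≡ x
translate-0 i x = updateAt-id-local i x (ℤ.+-identityˡ _)

translate-+ : ∀ (i : Fin n) k l x → translate i k (translate i l x) ≡ translate i (k ℤ.+ l) x
translate-+ i k l x = updateAt-updateAt-local i x (sym (ℤ.+-assoc k l _))

translate-comm : ∀ {i j : Fin n} k l x → i ≢ j →
                 translate i k (translate j l x) ≡ translate j l (translate i k x)
translate-comm {i = i} {j} k l x i≢j = updateAt-commutes i j i≢j x

unit : Sign → ℤ
unit Sign.+ = 1ℤ
unit Sign.- = -1ℤ

move : Fin n → Sign → Vec ℤ n → Vec ℤ n
move i s = translate i (unit s)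

move-opposite : ∀ (i : Fin n) s x → move i (opposite s) (move i s x) ≡ x
move-opposite i s x = trans (translate-+ i (unit (opposite s)) (unit s) x) (trans (cong (λ k → translate i k x) (cancel s)) (translate-0 i x))
  where
  cancel : ∀ s → unit (opposite s) ℤ.+ unit s ≡ 0ℤ
  cancel Sign.+ = refl
  cancel Sign.- = refl

-- The sum is left unevaluated to treat both signs at once; for a concrete sign it computes to 3 or
-- -3.
move³≡translate : ∀ (i : Fin n) s x → move i s (move i s (move i s x)) ≡
                  translate i (unit s ℤ.+ (unit s ℤ.+ unit s)) x
move³≡translate i s x = trans (cong (move i s) (translate-+ i (unit s) (unit s) x))
                              (translate-+ i (unit s) (unit s ℤ.+ unit s) x)

∣i-i+unit∣≡1 : ∀ s i → ℤ.∣ i ℤ.- (unit s ℤ.+ i) ∣ ≡ 1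
∣i-i+unit∣≡1 s i = trans (cong ℤ.∣_∣ (negated i (unit s))) (∣-unit∣ s)
  where
  negated : ∀ i k → i ℤ.- (k ℤ.+ i) ≡ ℤ.- k
  negated = solve-∀

  ∣-unit∣ : ∀ s → ℤ.∣ ℤ.- unit s ∣ ≡ 1
  ∣-unit∣ Sign.+ = refl
  ∣-unit∣ Sign.- = refl

private
  j≡ : ∀ i j → j ≡ ℤ.- (i ℤ.- j) ℤ.+ i
  j≡ = solve-∀

∣i-j∣≡1⇒unit : ∀ i j → ℤ.∣ i ℤ.- j ∣ ≡ 1 → ∃[ s ] j ≡ unit s ℤ.+ i
∣i-j∣≡1⇒unit i j eq with i ℤ.- j in i-j≡
-- The sign flips because the difference is `i` minus `j`; all other values contradict `eq`.
... | + 1      = Sign.- , trans (j≡ i j) (cong (λ k → ℤ.- k ℤ.+ i) i-j≡)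
... | -[1+ 0 ] = Sign.+ , trans (j≡ i j) (cong (λ k → ℤ.- k ℤ.+ i) i-j≡)

∣i-j∣≡0⇒i≡j : ∀ i j → ℤ.∣ i ℤ.- j ∣ ≡ 0 → i ≡ j
∣i-j∣≡0⇒i≡j i j eq = ℤ.i-j≡0⇒i≡j i j (ℤ.∣i∣≡0⇒i≡0 eq)

∣i-i∣≡0 : ∀ i → ℤ.∣ i ℤ.- i ∣ ≡ 0
∣i-i∣≡0 i = cong ℤ.∣_∣ (ℤ.+-inverseʳ i)

ℓ₁-self : ∀ (x : Vec ℤ n) → ℓ₁-distance x x ≡ 0
ℓ₁-self []      = refl
ℓ₁-self (a ∷ x) rewrite ∣i-i∣≡0 a = ℓ₁-self x

ℓ₁≡0⇒≡ : ∀ (x y : Vec ℤ n) → ℓ₁-distance x y ≡ 0 → x ≡ y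
ℓ₁≡0⇒≡ []      []      _ = refl
ℓ₁≡0⇒≡ (a ∷ x) (b ∷ y) d≡0
  with refl ← ∣i-j∣≡0⇒i≡j a b (ℕ.m+n≡0⇒m≡0 _ d≡0)
     | refl ← ℓ₁≡0⇒≡ x y (ℕ.m+n≡0⇒n≡0 ℤ.∣ a ℤ.- b ∣ d≡0) = refl

~-move : ∀ i s (x : Vec ℤ n) → ℓ₁-distance x (move i s x) ≡ 1
~-move zero    s (a ∷ x) rewrite ∣i-i+unit∣≡1 s a | ℓ₁-self x = refl
~-move (suc i) s (a ∷ x) rewrite ∣i-i∣≡0 a = ~-move i s x

-- Natural numbers with sum 1 are all 0 except for a single 1, and the recursion searches for its
-- coordinate.
~⇒move : ∀ (x y : Vec ℤ n) → ℓ₁-distance x y ≡ 1 → ∃₂ λ i s → y ≡ move i s x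
~⇒move [] [] ()
~⇒move (a ∷ x) (b ∷ y) d≡1 with ℤ.∣ a ℤ.- b ∣ in eq
... | 0 with refl ← ∣i-j∣≡0⇒i≡j a b eq | i , s , refl ← ~⇒move x y d≡1 = suc i , s , refl
... | 1 with s , refl ← ∣i-j∣≡1⇒unit a b eq | refl ← ℓ₁≡0⇒≡ x y (ℕ.suc-injective d≡1) = zero , s , refl

lookup-injective : ∀ (x y : Vec A n) → (∀ i → lookup x i ≡ lookup y i) → x ≡ y
lookup-injective x y eq = trans (sym (tabulate∘lookup x)) (trans (tabulate-cong eq) (tabulate∘lookup y))

unit+i≢i : ∀ s i → unit s ℤ.+ i ≢ i
unit+i≢i s i eq = case trans (sym (∣i-i+unit∣≡1 s i)) (trans (cong (λ k → ℤ.∣ i ℤ.- k ∣) eq) (∣i-i∣≡0 i)) of λ ()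

-- Residues modulo 3

residue : Fin 3 → ℤ
residue r = + toℕ r

-- Every clause relies on _%ℕ 3 reducing definitionally by whole periods.
3-periodic⇒residue : (Q : Pred ℤ ℓ) → (∀ k → Q k ⇔ Q (+ 3 ℤ.+ k)) →
                     ∀ k → Q k ⇔ Q (residue (mod3 k))
3-periodic⇒residue Q period = go
  where
  go : ∀ k → Q k ⇔ Q (residue (mod3 k))
  go (+ 0) = ⇔-refl
  go (+ 1) = ⇔-refl
  go (+ 2) = ⇔-refl
  go (+ suc (suc (suc k))) = ⇔-trans (⇔-sym (period (+ k))) (go (+ k))
  go -[1+ 0 ] = period -[1+ 0 ]
  go -[1+ 1 ] = period -[1+ 1 ]
  go -[1+ 2 ] = period -[1+ 2 ]
  go -[1+ suc (suc (suc k)) ] = ⇔-trans (period -[1+ suc (suc (suc k)) ]) (go -[1+ k ])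

-- Coordinates are reduced one at a time; the recursion runs with the first one fixed at its
-- residue.
3-periodic⇒residues : (P : Pred (Vec ℤ n) ℓ) → (∀ i x → P x ⇔ P (translate i (+ 3) x)) →
                      ∀ x → P x ⇔ P (map residue (map mod3 x))
3-periodic⇒residues P period [] = ⇔-refl
3-periodic⇒residues P period (a ∷ x) = ⇔-trans
  (3-periodic⇒residue (λ k → P (k ∷ x)) (λ k → period zero (k ∷ x)) a)
  (3-periodic⇒residues (λ y → P (residue (mod3 a) ∷ y)) (λ i y → period (suc i) (_ ∷ y)) x)

mod3-+3 : ∀ k → mod3 (+ 3 ℤ.+ k) ≡ mod3 k
mod3-+3 (+ k)    = refl
mod3-+3 -[1+ 0 ] = refl
mod3-+3 -[1+ 1 ] = refl
mod3-+3 -[1+ 2 ] = refl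
mod3-+3 -[1+ suc (suc (suc k)) ] = refl

mod3-residue : ∀ r → mod3 (residue r) ≡ r
mod3-residue zero             = refl
mod3-residue (suc zero)       = refl
mod3-residue (suc (suc zero)) = refl

rotate : Sign → Fin 3 → Fin 3
rotate s r = mod3 (unit s ℤ.+ residue r)

-- The equation is itself a 3-periodic predicate of `k`, so it suffices to verify it at residues.
mod3-unit : ∀ s k → mod3 (unit s ℤ.+ k) ≡ rotate s (mod3 k)
mod3-unit s k = from (3-periodic⇒residue (λ l → mod3 (unit s ℤ.+ l) ≡ rotate s (mod3 l)) period k)
  (cong (rotate s) (sym (mod3-residue (mod3 k))))
  where
  shift : ∀ l → mod3 (unit s ℤ.+ (+ 3 ℤ.+ l)) ≡ mod3 (unit s ℤ.+ l)
  shift l = trans (cong mod3 (swap (unit s) l)) (mod3-+3 (unit s ℤ.+ l))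
    where
    swap : ∀ u l → u ℤ.+ (+ 3 ℤ.+ l) ≡ + 3 ℤ.+ (u ℤ.+ l)
    swap = solve-∀

  period : ∀ l → (mod3 (unit s ℤ.+ l) ≡ rotate s (mod3 l)) ⇔
                 (mod3 (unit s ℤ.+ (+ 3 ℤ.+ l)) ≡ rotate s (mod3 (+ 3 ℤ.+ l)))
  period l = mk⇔
    (λ eq → trans (shift l) (trans eq (cong (rotate s) (sym (mod3-+3 l)))))
    (λ eq → trans (sym (shift l)) (trans eq (cong (rotate s) (mod3-+3 l))))

rotate-≢ : ∀ s r → r ≢ rotate s r
rotate-≢ Sign.+ zero ()
rotate-≢ Sign.+ (suc zero) ()
rotate-≢ Sign.+ (suc (suc zero)) ()
rotate-≢ Sign.- zero ()
rotate-≢ Sign.- (suc zero) ()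
rotate-≢ Sign.- (suc (suc zero)) ()

-- 1 and -1 are distinct modulo 3, which makes the projection injective along each direction.
rotate-injective : ∀ s t r → rotate s r ≡ rotate t r → s ≡ t
rotate-injective Sign.+ Sign.+ _ _ = refl
rotate-injective Sign.- Sign.- _ _ = refl
rotate-injective Sign.+ Sign.- zero ()
rotate-injective Sign.+ Sign.- (suc zero) ()
rotate-injective Sign.+ Sign.- (suc (suc zero)) ()
rotate-injective Sign.- Sign.+ zero ()
rotate-injective Sign.- Sign.+ (suc zero) ()
rotate-injective Sign.- Sign.+ (suc (suc zero)) ()

-- Modulo 3 the only nonzero differences are 1 and -1, so every Hamming edge lifts to a unit step. A
-- larger modulus would fail here.
≢⇒rotate : ∀ r t → r ≢ t → ∃[ s ] rotate s r ≡ t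
≢⇒rotate zero             zero             r≢t = contradiction refl r≢t
≢⇒rotate zero             (suc zero)       _   = Sign.+ , refl
≢⇒rotate zero             (suc (suc zero)) _   = Sign.- , refl
≢⇒rotate (suc zero)       zero             _   = Sign.- , refl
≢⇒rotate (suc zero)       (suc zero)       r≢t = contradiction refl r≢t
≢⇒rotate (suc zero)       (suc (suc zero)) _   = Sign.+ , refl
≢⇒rotate (suc (suc zero)) zero             _   = Sign.+ , refl
≢⇒rotate (suc (suc zero)) (suc zero)       _   = Sign.- , refl
≢⇒rotate (suc (suc zero)) (suc (suc zero)) r≢t = contradiction refl r≢t

lookup-mod3-move : ∀ (i : Fin n) s x →
                   lookup (map mod3 (move i s x)) i ≡ rotate s (lookup (map mod3 x) i)
lookup-mod3-move i s x = begin
  lookup (map mod3 (move i s x)) i     ≡⟨ lookup-map i mod3 (move i s x) ⟩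
  mod3 (lookup (move i s x) i)         ≡⟨ cong mod3 (lookup∘updateAt i x) ⟩
  mod3 (unit s ℤ.+ lookup x i)         ≡⟨ mod3-unit s (lookup x i) ⟩
  rotate s (mod3 (lookup x i))         ≡⟨ cong (rotate s) (lookup-map i mod3 x) ⟨
  rotate s (lookup (map mod3 x) i)     ∎
  where open ≡-Reasoning

lookup-mod3-move′ : ∀ {i j : Fin n} s x → j ≢ i →
                    lookup (map mod3 (move i s x)) j ≡ lookup (map mod3 x) j
lookup-mod3-move′ {i = i} {j} s x j≢i =
  trans (lookup-map j mod3 (move i s x))
    (trans (cong mod3 (lookup∘updateAt′ j i j≢i x)) (sym (lookup-map j mod3 x)))

map-mod3-residue : ∀ (y : Vec (Fin 3) n) → map mod3 (map residue y) ≡ y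
map-mod3-residue []      = refl
map-mod3-residue (r ∷ y) rewrite mod3-residue r | map-mod3-residue y = refl

mod3-covering : ∀ n → Covering (GridGraph n) (HammingGraph n 3)
mod3-covering n = record
  { proj         = map mod3
  ; section      = map residue
  ; proj-section = map-mod3-residue
  ; proj-~       = λ {u} {v} → project u v
  ; lift-~       = λ {u} {y} → lift u y
  ; proj-inj     = λ {u} {v} {w} → injective u v w
  }
  where
  open Graph (HammingGraph n 3) using (_~_)

  project : ∀ u v → ℓ₁-distance u v ≡ 1 → map mod3 u ~ map mod3 v
  project u v u~v with i , s , refl ← ~⇒move u v u~v =
    i ,
    (λ eq → rotate-≢ s _ (trans eq (lookup-mod3-move i s u))) ,
    λ {j} neq → decidable-stable (i ≟ j) λ i≢j → neq (sym (lookup-mod3-move′ s u (i≢j ∘ sym)))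

  lift : ∀ u y → map mod3 u ~ y → ∃[ v ] ℓ₁-distance u v ≡ 1 × map mod3 v ≡ y
  lift u y (i , neq , unique) with s , rotate≡ ← ≢⇒rotate _ _ neq =
    move i s u , ~-move i s u , lookup-injective _ _ pointwise
    where
    pointwise : ∀ j → lookup (map mod3 (move i s u)) j ≡ lookup y j
    pointwise j with i ≟ j
    ... | yes refl = trans (lookup-mod3-move i s u) rotate≡
    ... | no  i≢j  = trans (lookup-mod3-move′ s u (i≢j ∘ sym)) (decidable-stable (_ ≟ _) (i≢j ∘ unique))

  injective : ∀ u v w → ℓ₁-distance u v ≡ 1 → ℓ₁-distance u w ≡ 1 → map mod3 v ≡ map mod3 w → v ≡ w
  injective u v w u~v u~w eq
    with i , s , refl ← ~⇒move u v u~v | j , t , refl ← ~⇒move u w u~w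
    with i ≟ j
  ... | yes refl = cong (λ s → move i s u)
    (rotate-injective s t _ (trans (sym (lookup-mod3-move i s u))
      (trans (cong (λ x → lookup x i) eq) (lookup-mod3-move i t u))))
  -- At coordinate `i` the move along `j` leaves the residue of `u` unchanged, while the move along
  -- `i` rotates it.
  ... | no i≢j = contradiction
    (trans (sym (lookup-mod3-move′ t u i≢j)) (trans (cong (λ x → lookup x i) (sym eq)) (lookup-mod3-move i s u)))
    (rotate-≢ s _)

-- Periodicity of the code

opposite-or-equal : ∀ s t → t ≡ s ⊎ t ≡ opposite s
opposite-or-equal Sign.+ Sign.+ = inj₁ refl
opposite-or-equal Sign.+ Sign.- = inj₂ refl
opposite-or-equal Sign.- Sign.+ = inj₂ refl
opposite-or-equal Sign.- Sign.- = inj₁ refl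

-- The covering radius has the form `suc ρ`, so that the indices 0 and 1 are the constructors `zero`
-- and `suc zero`.
module Periodicity {n} {C : Pred (Vec ℤ n) ℓ} {ρ} {α : Matrix (suc (suc ρ))}
  (crc : IsCRC (GridGraph n) C (suc ρ) α)
  (a₀≡0 : α zero zero ≡ 0) (a₁≡1 : α (suc zero) (suc zero) ≡ 1) where

  open Graph (GridGraph n) using (_~_; ~-sym)
  open IsCRC crc

  C₁ : Pred (Vec ℤ n) ℓ
  C₁ = Layer (GridGraph n) C 1

  C₁⇒∉C : ∀ {v} → v ∈ C₁ → v ∉ C
  C₁⇒∉C = layer-1⇒∉ (GridGraph n) C

  C₁-neighbours : ∀ {v} → v ∈ C₁ → HasCardinality (λ w → v ~ w × w ∈ C₁) 1
  C₁-neighbours {v} v∈C₁ = subst (HasCardinality _) a₁≡1 (regular (suc zero) (suc zero) v v∈C₁)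

  move-back : ∀ i s x → move i s x ~ x
  move-back i s x = ~-sym {x} (~-move i s x)

  move-∈C₁ : ∀ {v} i s → v ∈ C → move i s v ∈ C₁
  move-∈C₁ {v} i s v∈C = neighbour⇒layer-1 (GridGraph n) C
    (λ w∈C → cardinality-0⇒∉ (subst (HasCardinality _) a₀≡0 (regular zero zero v (from ∈⇔ v∈C)))
      (~-move i s v , from ∈⇔ w∈C))
    (move-back i s v) v∈C
    where
    ∈⇔ : ∀ {w} → w ∈ Layer (GridGraph n) C 0 ⇔ w ∈ C
    ∈⇔ = layer-0⇔∈ (GridGraph n) C

  -- Otherwise `move i s v` and `move j t v` would be two neighbours in `C₁` of a vertex of `C₁`,
  -- against `a₁≡1`; coordinate `i` tells them apart.
  diagonal-∉C₁ : ∀ {v i j} s t → i ≢ j → v ∈ C → move j t (move i s v) ∉ C₁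
  diagonal-∉C₁ {v} {i} {j} s t i≢j v∈C u∈C₁ = unit+i≢i s (lookup v i) (begin
    unit s ℤ.+ lookup v i     ≡⟨ lookup∘updateAt i v ⟨
    lookup (move i s v) i     ≡⟨ cong (λ x → lookup x i) moves≡ ⟩
    lookup (move j t v) i     ≡⟨ lookup∘updateAt′ i j i≢j v ⟩
    lookup v i                ∎)
    where
    open ≡-Reasoning
    moves≡ : move i s v ≡ move j t v
    moves≡ = cardinality-1⇒unique (C₁-neighbours u∈C₁)
      (move-back j t (move i s v) , move-∈C₁ i s v∈C)
      (subst (_~ move j t v) (translate-comm (unit s) (unit t) v i≢j) (move-back i s (move j t v)) ,
       move-∈C₁ j t v∈C)

  -- The unique neighbour of `move i s v` in `C₁` is neither diagonal to `v` nor the codeword `v`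
  -- itself, which leaves only the next vertex on the line.
  move²-∈C₁ : ∀ {v} i s → v ∈ C → move i s (move i s v) ∈ C₁
  move²-∈C₁ {v} i s v∈C
    with w , v~w , w∈C₁ ← cardinality-1⇒nonempty (C₁-neighbours (move-∈C₁ i s v∈C))
    with j , t , refl ← ~⇒move (move i s v) w v~w
    with i ≟ j
  ... | no i≢j = contradiction w∈C₁ (diagonal-∉C₁ s t i≢j v∈C)
  ... | yes refl with opposite-or-equal s t
  ...   | inj₁ refl = w∈C₁
  ...   | inj₂ refl = contradiction v∈C (C₁⇒∉C (subst (_∈ C₁) (move-opposite i s v) w∈C₁))

  move²-codeword : ∀ {v c} i s → v ∈ C → move i s (move i s v) ~ c → c ∈ C →
                   c ≡ move i s (move i s (move i s v))
  move²-codeword {v} {c} i s v∈C w~c c∈C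
    with j , t , refl ← ~⇒move (move i s (move i s v)) c w~c
    with i ≟ j
  -- Seen from the codeword `c`, the vertex `move i s v` is diagonal: undo the step along `j`, then
  -- one step along `i`. Yet it lies in `C₁` as a neighbour of `v`.
  ... | no i≢j = contradiction (subst (_∈ C₁) (sym back) (move-∈C₁ i s v∈C))
                               (diagonal-∉C₁ (opposite t) (opposite s) (i≢j ∘ sym) c∈C)
    where
    back : move i (opposite s) (move j (opposite t) (move j t (move i s (move i s v)))) ≡ move i s v
    back = trans (cong (move i (opposite s)) (move-opposite j t _)) (move-opposite i s _)
  ... | yes refl with opposite-or-equal s t
  ...   | inj₁ refl = refl
  ...   | inj₂ refl = contradiction (subst (_∈ C) (move-opposite i s (move i s v)) c∈C)
                                    (C₁⇒∉C (move-∈C₁ i s v∈C))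

  move³-∈C : ∀ {v} i s → v ∈ C → move i s (move i s (move i s v)) ∈ C
  move³-∈C i s v∈C =
    let c , w~c , c∈C = layer-1⇒neighbour (GridGraph n) C (move²-∈C₁ i s v∈C) in
    subst (_∈ C) (move²-codeword i s v∈C w~c c∈C) c∈C

  -- The argument supplies a direction, so it encodes that the dimension is positive. A codeword `c`
  -- exists because some vertex has a distance to `C`; the count is taken at the vertex two steps
  -- from `c`.
  c₁≡1 : Fin n → α (suc zero) zero ≡ 1
  c₁≡1 i with v , (c , c∈C , _) , _ ← proj₂ coveringRadius =
    singleton⇒cardinality-1 (regular (suc zero) zero _ (move²-∈C₁ i Sign.+ c∈C))
      (~-move i Sign.+ (move i Sign.+ (move i Sign.+ c)) , from (layer-0⇔∈ (GridGraph n) C) (move³-∈C i Sign.+ c∈C))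
      (λ { (w~c , c∈C₀) → move²-codeword i Sign.+ c∈C w~c (to (layer-0⇔∈ (GridGraph n) C) c∈C₀) })

  C-3-periodic : ∀ i x → x ∈ C ⇔ translate i (+ 3) x ∈ C
  C-3-periodic i x = mk⇔
    (λ x∈C → subst (_∈ C) (move³≡translate i Sign.+ x) (move³-∈C i Sign.+ x∈C))
    -- The converse walks back with three negative moves from the translated vertex.
    (λ y∈C → subst (_∈ C)
      (trans (move³≡translate i Sign.- (translate i (+ 3) x))
             (trans (translate-+ i (ℤ.- + 3) (+ 3) x) (translate-0 i x)))
      (move³-∈C i Sign.- y∈C))

mainTheorem7 : ∀ {ℓ : Level} (n : ℕ) → 1 ≤ n →
    (C : Pred (Vec ℤ n) ℓ) (ρ : ℕ) (α : Matrix (suc ρ)) →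
    IsCRC (GridGraph n) C ρ α →
    (1≤ρ : 1 ≤ ρ) →
    α index₀ index₀ ≡ 0 →
    α (index₁ 1≤ρ) (index₁ 1≤ρ) ≡ 1 →
    α (index₁ 1≤ρ) index₀ ≡ 1 ×
    (Σ[ D ∈ Pred (Vec (Fin 3) n) ℓ ] IsCRC (HammingGraph n 3) D ρ α × C ≐ (λ x → map mod3 x ∈ D))
mainTheorem7 n@(suc _) _ C (suc ρ) α crc (s≤s _) a₀≡0 a₁≡1 =
  c₁≡1 zero ,
  -- `D` is tested on representatives with entries 0, 1, 2, which keeps it at the level of `C`;
  -- periodicity makes the choice of representatives immaterial.
  (λ y → map residue y ∈ C) ,
  isCRC-proj (mod3-covering n) C⇔D crc ,
  (λ {x} → to (C⇔D x)) , (λ {x} → from (C⇔D x))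
  where
  open Periodicity crc a₀≡0 a₁≡1

  C⇔D : ∀ x → x ∈ C ⇔ map residue (map mod3 x) ∈ C
  C⇔D = 3-periodic⇒residues C C-3-periodic
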